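{- For all $n \ge 8$, $N_{1,3}(n) = N_{1,3}(n-2) + N_{1,3}(n-4)$. Moreover, $N_{1,3}(n) = F_{n/2}$ for every even $n \ge 4$, and $N_{1,3}(n) = 0$ for every odd $n \ge 5$, where $F_m$ denotes the $m$-th Fibonacci number with $F_0 = 0$, $F_1 = 1$.
   Context: For positive integers $a<b$ and $n \ge 3$, an $(a,b)$-necklace of length $n$ is a circular arrangement of the integers $0,1,\ldots,n-1$ (each used exactly once) such that any two adjacent entries have difference $\pm a$ or $\pm b$. Two necklaces are considered the same if one is obtained from the other by rotation or reflection. $N_{a,b}(n)$ denotes the number of distinct $(a,b)$-necklaces of length $n$; equivalently, it is the number of Hamiltonian cycles (as undirected subgraphs) of the graph on $\{0,1,\ldots,n-1\}$ in which $x,y$ are adjacent if and only if $|x-y| \in \{a,b\}$. -}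

module Defs where

open import Data.Fin.Base using (Fin; toℕ; opposite)
open import Data.Fin.Properties using (_≟_; any?; all?)
open import Data.List.Base
  using (List; []; _∷_; [_]; length; filter; deduplicate; allFin; cartesianProductWith)
open import Data.Nat.Base using (ℕ; zero; suc; _+_; ∣_-_∣)
import Data.Nat.Properties as ℕ
open import Data.Nat.DivMod using (_mod_)
open import Data.Product using (_×_; _,_; ∃; ∃!)
open import Data.Sum.Base using (_⊎_)
open import Data.Vec.Base using (Vec; []; _∷_; lookup)
open import Relation.Binary.PropositionalEquality using (_≡_)
open import Relation.Nullary using (Dec)
open import Relation.Nullary.Decidable using (map′; _×-dec_; _⊎-dec_; _→-dec_)

-- Positions on the circle are elements of Fin n, read modulo n.

shift : ∀ {n} → ℕ → Fin n → Fin n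
shift {suc m} k i = (k + toℕ i) mod suc m

next : ∀ {n} → Fin n → Fin n
next = shift 1

-- The entry v[i] of an arrangement v : Vec (Fin n) n is the integer toℕ v[i]
-- in {0, …, n-1}.

Adjacent : ∀ {n} (a b : ℕ) → Fin n → Fin n → Set
Adjacent a b x y = ∣ toℕ x - toℕ y ∣ ≡ a ⊎ ∣ toℕ x - toℕ y ∣ ≡ b

UsedOnce : ∀ {n} → Vec (Fin n) n → Fin n → Set
UsedOnce v x = ∃! _≡_ λ i → lookup v i ≡ x

IsNecklace : ∀ {n} (a b : ℕ) → Vec (Fin n) n → Set
IsNecklace a b v =
  (∀ x → UsedOnce v x) × (∀ i → Adjacent a b (lookup v i) (lookup v (next i)))

-- The symmetries of the circle are the n rotations i ↦ k + i and the n
-- reflections i ↦ n - 1 - (k + i).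

SameNecklace : ∀ {n} → Vec (Fin n) n → Vec (Fin n) n → Set
SameNecklace {n} u v = ∃ λ (k : Fin n) →
    (∀ i → lookup v i ≡ lookup u (shift (toℕ k) i))
  ⊎ (∀ i → lookup v i ≡ lookup u (opposite (shift (toℕ k) i)))

adjacent? : ∀ {n} a b (x y : Fin n) → Dec (Adjacent a b x y)
adjacent? a b x y =
  (∣ toℕ x - toℕ y ∣ ℕ.≟ a) ⊎-dec (∣ toℕ x - toℕ y ∣ ℕ.≟ b)

usedOnce? : ∀ {n} (v : Vec (Fin n) n) x → Dec (UsedOnce v x)
usedOnce? v x = any? λ i →
  (lookup v i ≟ x) ×-dec
  map′ (λ f {j} → f j) (λ f j → f {j})
       (all? λ j → (lookup v j ≟ x) →-dec (i ≟ j))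

isNecklace? : ∀ {n} a b (v : Vec (Fin n) n) → Dec (IsNecklace a b v)
isNecklace? a b v =
  all? (usedOnce? v) ×-dec
  all? λ i → adjacent? a b (lookup v i) (lookup v (next i))

sameNecklace? : ∀ {n} (u v : Vec (Fin n) n) → Dec (SameNecklace u v)
sameNecklace? u v = any? λ k →
  all? (λ i → lookup v i ≟ lookup u (shift (toℕ k) i)) ⊎-dec
  all? (λ i → lookup v i ≟ lookup u (opposite (shift (toℕ k) i)))

-- Every vector of length k over Fin n, listed exactly once.
allVecs : ∀ n k → List (Vec (Fin n) k)
allVecs n zero    = [ [] ]
allVecs n (suc k) = cartesianProductWith _∷_ (allFin n) (allVecs n k)

-- The number of (a,b)-necklaces of length n: deduplicate keeps one
-- representative of each class under rotation and reflection.  The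
-- definition is meant for 0 < a < b and n ≥ 3 only.
N : (a b n : ℕ) → ℕ
N a b n = length (deduplicate sameNecklace? (filter (isNecklace? a b) (allVecs n n)))

F : ℕ → ℕ
F 0             = 0
F 1             = 1
F (suc (suc m)) = F (suc m) + F m

{-# OPTIONS --safe #-}

-- In a (1,3)-necklace the entry 0 has the neighbours 1 and 3, so every class
-- contains exactly one arrangement of the form 0, 1, ys, 3.  The path ys is
-- found by growing the arc 3, 0, 1 at both ends.  Up to reversal the arc is
-- always in one of two states: either its ends are k and k + 1 and it consists
-- of all numbers below k + 2, or its ends are k + 1 and k + 3 and it consists
-- of all numbers below k + 4 except k + 2.  From the first state k must be
-- joined to k + 3, giving the second one.  From the second state either k + 1
-- is joined to k + 2 (first state, with k + 2 for k), or k + 1 is joined to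
-- k + 4, and then k + 3 must be continued by k + 2, k + 5 (first state, with
-- k + 4 for k).  So the number of completions of the second state satisfies
-- a(r) = a(r - 2) + a(r - 4) in the number r of unused entries.

module Submission where

open import Defs
open import Data.Nat using (ℕ; zero; suc; _+_; _*_; _∸_; _≤_; _<_; _/_; _%_; ∣_-_∣; z≤n; s≤s)
open import Data.Nat.Divisibility using (_∣_; _∤_; divides; ∣m∣n⇒∣m+n; ∣-refl; _∣0)
open import Data.Nat.DivMod
  using (m%n<n; m<n⇒m%n≡m; n%n≡0; %-distribˡ-+; m%n%n≡m%n; m*n/n≡m)
open import Data.Nat.Properties
  using (+-comm; +-suc; +-identityʳ; ≤-refl; ≤-trans; ≤-antisym; <⇒≢; n≤1+n; m≤m+n; m+n≮n;
         ∸-monoˡ-≤; m+[n∸m]≡n; ∣-∣-comm; ∣m-m+n∣≡n)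
open import Data.Fin.Base using (Fin; zero; suc; toℕ; fromℕ; fromℕ<; inject₁; opposite)
open import Data.Fin.Properties
  using (toℕ-injective; toℕ-fromℕ; toℕ-fromℕ<; toℕ-inject₁; toℕ<n; opposite-involutive)
open import Data.Fin.Induction using (<-weakInduction)
open import Data.Fin.Permutation
  using (Permutation′; permutation; _⟨$⟩ʳ_; _⟨$⟩ˡ_; inverseˡ; inverseʳ; id; flip; _∘ₚ_)
  renaming (reverse to oppositeₚ)
open import Data.Fin.Relation.Unary.Top using (view; ‵fromℕ; ‵inj₁; ‵inject₁)
open import Data.List.Base
  using (List; []; _∷_; _++_; [_]; _∷ʳ_; length; map; reverse; iterate; tabulate; filter;
         deduplicate; initLast; _∷ʳ′_)
import Data.List.Properties as List
open import Data.List.Membership.Propositional using (_∈_; lose; find)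
open import Data.List.Membership.Propositional.Properties
  using (∈-∃++; ∈-insert; ∈-++⁺ˡ; ∈-++⁺ʳ; ∈-++⁻; ∈-map⁺; ∈-map⁻; ∈-tabulate⁺; ∈-tabulate⁻;
         ∈-filter⁺; ∈-allFin; ∈-cartesianProductWith⁺)
open import Data.List.Membership.Propositional.Properties.WithK using (unique∧set⇒bag)
open import Data.List.Relation.Binary.BagAndSetEquality using (∼bag⇒↭)
open import Data.List.Relation.Binary.Permutation.Propositional
  using (_↭_; ↭-refl; ↭-sym; ↭-trans; prep; swap; ↭⇒↭ₛ)
open import Data.List.Relation.Binary.Permutation.Propositional.Properties
  using (∈-resp-↭; ↭-length; ↭-reverse; ↭-empty-inv; drop-∷; drop-mid; ¬x∷xs↭[]; ∷↭∷ʳ)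
  renaming (shift to ↭-shift)
open import Data.List.Relation.Binary.Permutation.Setoid.Properties using (Unique-resp-↭)
open import Data.List.Relation.Unary.All using (All; []; _∷_)
import Data.List.Relation.Unary.All as All
import Data.List.Relation.Unary.All.Properties as All
open import Data.List.Relation.Unary.AllPairs using (AllPairs; []; _∷_)
import Data.List.Relation.Unary.AllPairs as AllPairs
import Data.List.Relation.Unary.AllPairs.Properties as AllPairs
open import Data.List.Relation.Unary.Any using (here; there)
import Data.List.Relation.Unary.Any.Properties as Any
open import Data.List.Relation.Unary.Unique.Propositional using (Unique)
import Data.List.Relation.Unary.Unique.Propositional.Properties as Unique
open import Data.Product using (_×_; _,_; ∃; proj₁; proj₂)
open import Data.Sum using (_⊎_; inj₁; inj₂)
open import Data.Vec.Base using (Vec; []; _∷_; lookup)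
import Data.Vec.Base as Vec
import Data.Vec.Properties as Vec
open import Function using (_∘_; mk⇔)
open import Relation.Binary.Definitions using (Decidable)
open import Relation.Nullary using (¬_; Dec; ¬?; contradiction)
open import Relation.Binary.PropositionalEquality
  using (_≡_; _≢_; refl; sym; trans; cong; cong₂; subst; subst₂; setoid; module ≡-Reasoning)

-- Paths with steps of size 1 and 3

infix 4 _∼_

-- An inductive form of adjacency: matching on a step expresses one endpoint through the other, so
-- each number has exactly four candidate neighbours to examine.
data _∼_ : ℕ → ℕ → Set where
  up₁   : ∀ {x} → x ∼ 1 + x
  up₃   : ∀ {x} → x ∼ 3 + x
  down₁ : ∀ {x} → 1 + x ∼ x
  down₃ : ∀ {x} → 3 + x ∼ x

∼-sym : ∀ {x y} → x ∼ y → y ∼ x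
∼-sym up₁   = down₁
∼-sym up₃   = down₃
∼-sym down₁ = up₁
∼-sym down₃ = up₃

∣n-d+n∣≡d : ∀ n d → ∣ n - d + n ∣ ≡ d
∣n-d+n∣≡d n d = trans (cong (∣ n -_∣) (+-comm d n)) (∣m-m+n∣≡n n d)

∼⇒distance : ∀ {x y} → x ∼ y → ∣ x - y ∣ ≡ 1 ⊎ ∣ x - y ∣ ≡ 3
∼⇒distance {x}     up₁   = inj₁ (∣n-d+n∣≡d x 1)
∼⇒distance {x}     up₃   = inj₂ (∣n-d+n∣≡d x 3)
∼⇒distance {x} {y} down₁ = inj₁ (trans (∣-∣-comm x y) (∣n-d+n∣≡d y 1))
∼⇒distance {x} {y} down₃ = inj₂ (trans (∣-∣-comm x y) (∣n-d+n∣≡d y 3))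

distance⇒∼ : ∀ x y → ∣ x - y ∣ ≡ 1 ⊎ ∣ x - y ∣ ≡ 3 → x ∼ y
distance⇒∼ zero    _       (inj₁ refl) = up₁
distance⇒∼ zero    _       (inj₂ refl) = up₃
distance⇒∼ (suc _) zero    (inj₁ refl) = down₁
distance⇒∼ (suc _) zero    (inj₂ refl) = down₃
distance⇒∼ (suc x) (suc y) p with distance⇒∼ x y p
... | up₁   = up₁
... | up₃   = up₃
... | down₁ = down₁
... | down₃ = down₃

-- The list holds only the interior vertices. The ends of an arc stay outside the numbers still to
-- be placed, and a circuit is a path with equal endpoints.
data Path : ℕ → List ℕ → ℕ → Set where
  end : ∀ {a b} → a ∼ b → Path a [] b
  _∷_ : ∀ {a x xs b} → a ∼ x → Path x xs b → Path a (x ∷ xs) b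

Path-++⁺ : ∀ {a b x} xs {ys} → Path a xs x → Path x ys b → Path a (xs ++ x ∷ ys) b
Path-++⁺ []       (end p)   qs = p ∷ qs
Path-++⁺ (_ ∷ xs) (p ∷ ps) qs = p ∷ Path-++⁺ xs ps qs

Path-++⁻ : ∀ {a b x} xs {ys} → Path a (xs ++ x ∷ ys) b → Path a xs x × Path x ys b
Path-++⁻ []       (p ∷ qs) = end p , qs
Path-++⁻ (_ ∷ xs) (p ∷ ps) with qs , rs ← Path-++⁻ xs ps = p ∷ qs , rs

Path-reverse : ∀ {a b xs} → Path a xs b → Path b (reverse xs) a
Path-reverse (end p) = end (∼-sym p)
Path-reverse {a} {b} {x ∷ xs} (p ∷ ps) =
  subst (λ l → Path b l a) (sym (List.unfold-reverse x xs))
        (Path-++⁺ (reverse xs) (Path-reverse ps) (end (∼-sym p)))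

-- Completions of an arc

interval : ℕ → ℕ → List ℕ
interval = iterate suc

∈-interval⁻ : ∀ {x} s n → x ∈ interval s n → s ≤ x
∈-interval⁻ s (suc n) (here refl) = ≤-refl
∈-interval⁻ s (suc n) (there p)   = ≤-trans (n≤1+n s) (∈-interval⁻ (suc s) n p)

-- Serves to discard those neighbours of an arc end that already lie on the arc.
below∉interval : ∀ d s {n} → ¬ s ∈ interval (suc d + s) n
below∉interval d s {n} p = m+n≮n d s (∈-interval⁻ (suc d + s) n p)

-- The completions of an arc in the first state (twins) and in the second state
-- (gaps), given k and the number of unused entries (not counting the gap 2 + k);
-- leaps are the completions of the second state that begin with 4 + k.
twins : ℕ → ℕ → List (List ℕ)
gaps  : ℕ → ℕ → List (List ℕ)
leaps : ℕ → ℕ → List (List ℕ)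

twins k 0             = [ [] ]
twins k 1             = []
twins k (suc (suc r)) = map (λ ys → 3 + k ∷ reverse ys) (gaps k r)

gaps k r = map (2 + k ∷_) (twins (2 + k) r) ++ leaps k r

leaps k (suc (suc r)) = map (λ ys → 4 + k ∷ ys ++ 5 + k ∷ 2 + k ∷ []) (twins (4 + k) r)
leaps k _             = []

record Completes (a b : ℕ) (zs ys : List ℕ) : Set where
  constructor _,_
  field
    path : Path a ys b
    perm : ys ↭ zs

Twin Gap : ℕ → ℕ → List ℕ → Set
Twin k r = Completes k (1 + k) (interval (2 + k) r)
Gap  k r = Completes (1 + k) (3 + k) (2 + k ∷ interval (4 + k) r)

twins-sound : ∀ k r {ys} → ys ∈ twins k r → Twin k r ys
gaps-sound  : ∀ k r {ys} → ys ∈ gaps k r → Gap k r ys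
leaps-sound : ∀ k r {ys} → ys ∈ leaps k r → Gap k r ys

twins-sound k 0 (here refl) = end up₁ , ↭-refl
twins-sound k (suc (suc r)) ys∈ with zs , zs∈ , refl ← ∈-map⁻ _ ys∈ with gaps-sound k r zs∈
-- After the step from `k` to `3 + k` the rest runs from `3 + k` to `1 + k`, against the orientation
-- chosen in `Gap`; hence the reversal.
... | ps , π = (up₃ ∷ Path-reverse ps)
             , ↭-trans (prep _ (↭-trans (↭-reverse zs) π)) (swap _ _ ↭-refl)

gaps-sound k r ys∈ with ∈-++⁻ (map (2 + k ∷_) (twins (2 + k) r)) ys∈
... | inj₂ ys∈₂ = leaps-sound k r ys∈₂
... | inj₁ ys∈₁ with zs , zs∈ , refl ← ∈-map⁻ _ ys∈₁ with twins-sound (2 + k) r zs∈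
...   | ps , π = (up₁ ∷ ps) , prep _ π

leaps-sound k (suc (suc r)) ys∈ with zs , zs∈ , refl ← ∈-map⁻ _ ys∈
                                with twins-sound (4 + k) r zs∈
-- The part `zs` joins `4 + k` to `5 + k`; the gap is then filled by the steps from `5 + k` down to
-- `2 + k` and up to the end `3 + k`.
... | ps , π = (up₃ ∷ Path-++⁺ zs ps (down₃ ∷ end up₁))
             , ↭-trans (prep _ (↭-trans (↭-shift _ zs _) (prep _ (↭-shift _ zs []))))
                 (↭-trans (prep _ (swap _ _ (subst (_↭ _) (sym (List.++-identityʳ zs)) π)))
                          (swap _ _ ↭-refl))

twins-complete : ∀ k r {ys} → Twin k r ys → ys ∈ twins k r
gaps-complete  : ∀ k r {ys} → Gap k r ys → ys ∈ gaps k r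
leaps-complete : ∀ k r {ys} → Gap k r (4 + k ∷ ys) → 4 + k ∷ ys ∈ leaps k r

twins-complete k 0 (ps , π) with refl ← ↭-empty-inv π = here refl
twins-complete k (suc r) {[]} (ps , π) = contradiction (↭-sym π) ¬x∷xs↭[]
twins-complete k (suc r) {y ∷ ys} (p ∷ ps , π) with p
... | up₁   = contradiction (∈-resp-↭ π (here refl)) (below∉interval 0 (1 + k))
... | down₁ = contradiction (∈-resp-↭ π (here refl)) (below∉interval 2 y)
... | down₃ = contradiction (∈-resp-↭ π (here refl)) (below∉interval 4 y)
twins-complete k 1 (p ∷ ps , π) | up₃ with here () ← ∈-resp-↭ π (here refl)
twins-complete k (suc (suc r)) {_ ∷ ys} (p ∷ ps , π) | up₃ =
  subst (λ l → 3 + k ∷ l ∈ _) (List.reverse-involutive ys)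
    (∈-map⁺ _ (gaps-complete k r
      (Path-reverse ps , ↭-trans (↭-reverse ys) (drop-∷ (↭-trans π (swap _ _ ↭-refl))))))

gaps-complete k r {[]} (ps , π) = contradiction (↭-sym π) ¬x∷xs↭[]
gaps-complete k r {y ∷ ys} (p ∷ ps , π) with p
... | up₁   = ∈-++⁺ˡ (∈-map⁺ _ (twins-complete (2 + k) r (ps , drop-∷ π)))
... | up₃   = ∈-++⁺ʳ _ (leaps-complete k r (p ∷ ps , π))
... | down₁ with there y∈ ← ∈-resp-↭ π (here refl) = contradiction y∈ (below∉interval 3 y)
... | down₃ with ∈-resp-↭ π (here refl)
...   | there y∈ = contradiction y∈ (below∉interval 5 y)

-- The neighbours of 2 + k still available are 3 + k and 5 + k, hence the path
-- to 3 + k ends with 5 + k, 2 + k.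
leaps-complete k 0 (ps , π) with ∈-resp-↭ π (here refl)
... | here ()
... | there ()
leaps-complete k (suc r) (p ∷ ps , π)
  with drop-∷ (↭-trans π (swap (2 + k) (4 + k) ↭-refl))
... | π′ with ∈-∃++ (∈-resp-↭ (↭-sym π′) (here refl))
... | us , vs , refl with drop-mid us [] π′
... | π″ with Path-++⁻ us ps
... | qs , rs with initLast us
leaps-complete k (suc r) (p ∷ ps , π) | π′ | us , vs , refl | π″ | end q , rs | [] with () ← q
leaps-complete k (suc r) (p ∷ ps , π) | π′ | us , vs , refl | π″ | qs , rs | us′ ∷ʳ′ u
  with Path-++⁻ us′ qs
... | qs′ , end q with ∼-sym q | ∈-resp-↭ π″ (∈-++⁺ˡ (∈-++⁺ʳ us′ (here refl)))
... | up₁   | u∈ = contradiction u∈ (below∉interval 1 (3 + k))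
... | down₁ | u∈ = contradiction u∈ (below∉interval 3 u)
... | down₃ | u∈ = contradiction u∈ (below∉interval 5 u)
leaps-complete k 1 _ | π′ | us , vs , refl | π″ | qs , rs | us′ ∷ʳ′ u | _ | up₃ | ()
leaps-complete k (suc (suc r)) _ | π′ | us , vs , refl | π″ | qs , rs | us′ ∷ʳ′ u | qs′ , _ | up₃ | _
  with subst (_↭ _) (List.++-assoc us′ [ 5 + k ] vs) π″
... | π‴ with drop-mid us′ [] π‴
... | ρ with vs | rs
... | [] | _ = subst (λ l → 4 + k ∷ l ∈ leaps k (suc (suc r)))
      (sym (List.++-assoc us′ [ 5 + k ] [ 2 + k ]))
      (∈-map⁺ _ (twins-complete (4 + k) r (qs′ , subst (_↭ _) (List.++-identityʳ us′) ρ)))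
-- Nothing can stand between `2 + k` and the end `3 + k`: with `5 + k` already placed, all remaining
-- numbers are at least `6 + k`, too far from `2 + k`.
... | v ∷ vs′ | s ∷ _ with s | ∈-resp-↭ ρ (∈-insert us′)
...   | up₁   | v∈ = contradiction v∈ (below∉interval 2 (3 + k))
...   | up₃   | v∈ = contradiction v∈ (below∉interval 0 (5 + k))
...   | down₁ | v∈ = contradiction v∈ (below∉interval 4 v)
...   | down₃ | v∈ = contradiction v∈ (below∉interval 6 v)

-- Distinctness and number of the completions

twins-unique : ∀ k r → Unique (twins k r)
gaps-unique  : ∀ k r → Unique (gaps k r)
leaps-unique : ∀ k r → Unique (leaps k r)

twins-unique k 0             = [] ∷ []
twins-unique k 1             = []
twins-unique k (suc (suc r)) =
  Unique.map⁺ (List.reverse-injective ∘ List.∷-injectiveʳ) (gaps-unique k r)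

gaps-unique k r =
  Unique.++⁺ (Unique.map⁺ List.∷-injectiveʳ (twins-unique (2 + k) r)) (leaps-unique k r)
             (λ (p , q) → disjoint r p q)
  where
  disjoint : ∀ r {xs ys} → ys ∈ map (2 + k ∷_) xs → ¬ ys ∈ leaps k r
  -- The first entries differ: `2 + k` on one side, `4 + k` on the other.
  disjoint (suc (suc r)) p q with _ , _ , refl ← ∈-map⁻ _ p with _ , _ , () ← ∈-map⁻ _ q

leaps-unique k 0             = []
leaps-unique k 1             = []
leaps-unique k (suc (suc r)) =
  Unique.map⁺ (List.++-cancelʳ _ _ _ ∘ List.∷-injectiveʳ) (twins-unique (4 + k) r)

-- The Fibonacci numbers spread over the even arguments, with 0 at the odd ones. The recurrence runs
-- on `n` itself, so both parities are treated at once and no halving occurs.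
evenF : ℕ → ℕ
evenF 0 = 0
evenF 1 = 0
evenF 2 = 1
evenF 3 = 0
evenF (suc (suc (suc (suc n)))) = evenF (suc (suc n)) + evenF n

-- The counts do not depend on `k`. For `k = 0` the arguments `2 + r` and `4 + r` are the total
-- number of integers on the finished circle.
length-twins : ∀ k r → length (twins k r) ≡ evenF (2 + r)
length-gaps  : ∀ k r → length (gaps k r) ≡ evenF (4 + r)
length-leaps : ∀ k r → length (leaps k r) ≡ evenF r

length-twins k 0             = refl
length-twins k 1             = refl
length-twins k (suc (suc r)) = trans (List.length-map _ (gaps k r)) (length-gaps k r)

length-gaps k r = trans (List.length-++ (map (2 + k ∷_) (twins (2 + k) r)))
  (cong₂ _+_ (trans (List.length-map _ (twins (2 + k) r)) (length-twins (2 + k) r))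
             (length-leaps k r))

length-leaps k 0             = refl
length-leaps k 1             = refl
length-leaps k (suc (suc r)) = trans (List.length-map _ (twins (4 + k) r)) (length-twins (4 + k) r)

-- Counting classes

-- The pigeonhole principle for a relation: every `x` has a partner in `ys`, and no partner serves
-- two members of `xs`. Each induction step removes one partner from `ys`.
length-≤ : ∀ {A B : Set} (T : A → B → Set) xs {ys} →
           (∀ {x} → x ∈ xs → ∃ λ y → y ∈ ys × T x y) →
           AllPairs (λ x x′ → ∀ {y} → T x y → ¬ T x′ y) xs →
           length xs ≤ length ys
length-≤ T []       _     _          = z≤n
length-≤ T (x ∷ xs) cover (sep ∷ seps) with cover (here refl)
... | y , y∈ys , Txy with as , bs , refl ← ∈-∃++ y∈ys =
  subst (_ ≤_) (sym (↭-length (↭-shift y as bs)))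
        (s≤s (length-≤ T xs {as ++ bs} cover′ seps))
  where
  cover′ : ∀ {x′} → x′ ∈ xs → ∃ λ y′ → y′ ∈ as ++ bs × T x′ y′
  cover′ x′∈ with cover (there x′∈)
  ... | y′ , y′∈ , Tx′y′ with ∈-++⁻ as y′∈
  ...   | inj₁ y′∈as         = y′ , ∈-++⁺ˡ y′∈as , Tx′y′
  ...   | inj₂ (here refl)   = contradiction Tx′y′ (All.lookup sep x′∈ Txy)
  ...   | inj₂ (there y′∈bs) = y′ , ∈-++⁺ʳ as y′∈bs , Tx′y′

deduplicate-pairs : ∀ {A : Set} {R : A → A → Set} (R? : Decidable R) xs →
                    AllPairs (λ x y → ¬ R x y) (deduplicate R? xs)
deduplicate-pairs R? []       = []
deduplicate-pairs R? (x ∷ xs) =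
  All.all-filter (¬? ∘ R? x) (deduplicate R? xs) ∷
  AllPairs.filter⁺ (¬? ∘ R? x) (deduplicate-pairs R? xs)

-- Classes and codes are compared in both directions by `length-≤`: `cover` and `injective` give at
-- most as many classes as codes, `represent` and `functional` at least as many.
length-classes :
  ∀ {A B : Set} {R : A → A → Set} {P : A → Set} (R? : Decidable R) →
  (∀ x → R x x) → (∀ x y z → R x y → R y z → R x z) →
  (P? : ∀ x → Dec (P x)) → ∀ {xs} → (∀ x → x ∈ xs) →
  (Code : A → B → Set) → ∀ {bs} → Unique bs →
  (∀ x y {b} → R x y → Code y b → Code x b) →
  (∀ x → P x → ∃ λ b → b ∈ bs × Code x b) →
  (∀ {b} → b ∈ bs → ∃ λ x → P x × Code x b) →
  (∀ x y {b} → Code x b → Code y b → R x y) →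
  (∀ {b c} x → P x → Code x b → Code x c → b ≡ c) →
  length (deduplicate R? (filter P? xs)) ≡ length bs
length-classes {A} {P = P} R? R-refl R-trans P? {xs} ∈xs Code {bs} unique
               resp cover represent injective functional = ≤-antisym
  (length-≤ Code classes (λ {x} x∈ → cover x (All.lookup classes-P x∈))
    (AllPairs.map (λ {x} {y} ¬Rxy {_} c c′ → ¬Rxy (injective x y c c′))
                  (deduplicate-pairs R? (filter P? xs))))
  (length-≤ (λ b x → Code x b × P x) bs represent′
    (AllPairs.map (λ b≢c {x} (p , Px) (q , _) → b≢c (functional x Px p q)) unique))
  where
  classes : List A
  classes = deduplicate R? (filter P? xs)

  classes-P : All P classes
  classes-P = All.deduplicate⁺ R? (All.all-filter P? xs)

  represent′ : ∀ {b} → b ∈ bs → ∃ λ x → x ∈ classes × Code x b × P x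
  represent′ b∈ with y , Py , c ← represent b∈ =
    -- The element `y` may itself have been removed as a duplicate; some `x` related to it survives
    -- and has the same code by `resp`.
    let x , x∈ , Rxy = find (Any.deduplicate⁺ R? (λ {v} {w} q p → R-trans w v y q p)
                               (lose (∈-filter⁺ P? (∈xs y) Py) (R-refl y)))
    in x , x∈ , resp x y Rxy c , All.lookup classes-P x∈

-- Symmetries of the circle

-- With `next-fromℕ` this replaces arithmetic modulo `n` by a case distinction on whether a position
-- is the last one.
next-inject₁ : ∀ {n} (i : Fin n) → next (inject₁ i) ≡ suc i
next-inject₁ {n} i = toℕ-injective (begin
  toℕ (next (inject₁ i))           ≡⟨ toℕ-fromℕ< (m%n<n (suc (toℕ (inject₁ i))) (suc n)) ⟩
  suc (toℕ (inject₁ i)) % suc n    ≡⟨ cong (λ k → suc k % suc n) (toℕ-inject₁ i) ⟩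
  suc (toℕ i) % suc n              ≡⟨ m<n⇒m%n≡m (s≤s (toℕ<n i)) ⟩
  suc (toℕ i)                      ∎)
  where open ≡-Reasoning

next-fromℕ : ∀ n → next (fromℕ n) ≡ zero
next-fromℕ n = toℕ-injective (begin
  toℕ (next (fromℕ n))         ≡⟨ toℕ-fromℕ< (m%n<n (suc (toℕ (fromℕ n))) (suc n)) ⟩
  suc (toℕ (fromℕ n)) % suc n  ≡⟨ cong (λ k → suc k % suc n) (toℕ-fromℕ n) ⟩
  suc n % suc n                ≡⟨ n%n≡0 (suc n) ⟩
  0                            ∎)
  where open ≡-Reasoning

opposite-fromℕ : ∀ n → opposite (fromℕ n) ≡ zero
opposite-fromℕ n = opposite-involutive zero

opposite-inject₁ : ∀ {n} (i : Fin n) → opposite (inject₁ i) ≡ suc (opposite i)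
opposite-inject₁ i = begin
  opposite (inject₁ i)                        ≡⟨ cong (opposite ∘ inject₁) (opposite-involutive i) ⟨
  opposite (inject₁ (opposite (opposite i)))  ≡⟨ opposite-involutive (suc (opposite i)) ⟩
  suc (opposite i)                            ∎
  where open ≡-Reasoning

-- `opposite` reverses the direction of the circle. Consequently conjugating `next` by it yields the
-- inverse of `next`.
next-opposite-next : ∀ {n} (i : Fin (suc n)) → next (opposite (next i)) ≡ opposite i
next-opposite-next {n} i with view i
... | ‵fromℕ = begin
  next (opposite (next (fromℕ n)))  ≡⟨ cong (next ∘ opposite) (next-fromℕ n) ⟩
  next (fromℕ n)                    ≡⟨ next-fromℕ n ⟩
  zero                              ≡⟨ opposite-fromℕ n ⟨
  opposite (fromℕ n)                ∎
  where open ≡-Reasoning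
... | ‵inject₁ i′ = begin
  next (opposite (next (inject₁ i′)))  ≡⟨ cong (next ∘ opposite) (next-inject₁ i′) ⟩
  next (inject₁ (opposite i′))         ≡⟨ next-inject₁ (opposite i′) ⟩
  suc (opposite i′)                    ≡⟨ opposite-inject₁ i′ ⟨
  opposite (inject₁ i′)                ∎
  where open ≡-Reasoning

prev : ∀ {n} → Fin (suc n) → Fin (suc n)
prev i = opposite (next (opposite i))

next-prev : ∀ {n} (i : Fin (suc n)) → next (prev i) ≡ i
next-prev i = trans (next-opposite-next (opposite i)) (opposite-involutive i)

prev-next : ∀ {n} (i : Fin (suc n)) → prev (next i) ≡ i
prev-next i = trans (cong opposite (next-opposite-next i)) (opposite-involutive i)

nextₚ : ∀ {n} → Permutation′ (suc n)
nextₚ = permutation next prev next-prev prev-next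

-- On a circle of at least three positions the two neighbours of a position are distinct.
next²≢id : ∀ {n} (i : Fin (3 + n)) → next (next i) ≢ i
next²≢id {n} i eq with view i
... | ‵fromℕ with () ← trans (sym eq) (trans (cong next (next-fromℕ (2 + n))) (next-inject₁ zero))
... | ‵inj₁ {i = j} _ with view j
...   | ‵fromℕ with () ← trans (sym eq) (trans (cong next (next-inject₁ (fromℕ (1 + n)))) (next-fromℕ (2 + n)))
...   | ‵inject₁ k = <⇒≢ (s≤s (n≤1+n (toℕ k))) (sym (begin
  suc (suc (toℕ k))                            ≡⟨ cong toℕ (next-inject₁ (suc k)) ⟨
  toℕ (next (inject₁ (suc k)))                 ≡⟨ cong (toℕ ∘ next) (next-inject₁ (inject₁ k)) ⟨
  toℕ (next (next (inject₁ (inject₁ k))))      ≡⟨ cong toℕ eq ⟩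
  toℕ (inject₁ (inject₁ k))                    ≡⟨ toℕ-inject₁ (inject₁ k) ⟩
  toℕ (inject₁ k)                              ≡⟨ toℕ-inject₁ k ⟩
  toℕ k                                        ∎))
  where open ≡-Reasoning

shift-0 : ∀ {n} (i : Fin (suc n)) → shift 0 i ≡ i
shift-0 {n} i = toℕ-injective (trans (toℕ-fromℕ< (m%n<n (toℕ i) (suc n))) (m<n⇒m%n≡m (toℕ<n i)))

shift-toℕ-0 : ∀ {n} (i : Fin (suc n)) → shift (toℕ i) zero ≡ i
shift-toℕ-0 {n} i = toℕ-injective (begin
  toℕ (shift (toℕ i) zero)  ≡⟨ toℕ-fromℕ< (m%n<n (toℕ i + 0) (suc n)) ⟩
  (toℕ i + 0) % suc n       ≡⟨ cong (_% suc n) (+-identityʳ (toℕ i)) ⟩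
  toℕ i % suc n             ≡⟨ m<n⇒m%n≡m (toℕ<n i) ⟩
  toℕ i                     ∎)
  where open ≡-Reasoning

shift-suc : ∀ {n} k (i : Fin (suc n)) → shift (suc k) i ≡ next (shift k i)
shift-suc {n} k i = toℕ-injective (begin
  toℕ (shift (suc k) i)                 ≡⟨ toℕ-fromℕ< (m%n<n (suc (k + toℕ i)) m) ⟩
  suc (k + toℕ i) % m                   ≡⟨ %-distribˡ-+ 1 (k + toℕ i) m ⟩
  (1 % m + (k + toℕ i) % m) % m         ≡⟨ cong (λ x → (1 % m + x) % m) (m%n%n≡m%n (k + toℕ i) m) ⟨
  (1 % m + (k + toℕ i) % m % m) % m     ≡⟨ %-distribˡ-+ 1 ((k + toℕ i) % m) m ⟨
  suc ((k + toℕ i) % m) % m             ≡⟨ cong (λ x → suc x % m) (toℕ-fromℕ< (m%n<n (k + toℕ i) m)) ⟨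
  suc (toℕ (shift k i)) % m             ≡⟨ toℕ-fromℕ< (m%n<n (suc (toℕ (shift k i))) m) ⟨
  toℕ (next (shift k i))                ∎)
  where
  open ≡-Reasoning
  m = suc n

-- Built as an iterate of `next`, so that bijectivity and commutation with `next` come from the
-- recursion.
shiftₚ : ∀ {n} → ℕ → Permutation′ (suc n)
shiftₚ zero    = id
shiftₚ (suc k) = shiftₚ k ∘ₚ nextₚ

shiftₚ-shift : ∀ {n} k (i : Fin (suc n)) → shiftₚ k ⟨$⟩ʳ i ≡ shift k i
shiftₚ-shift zero    i = sym (shift-0 i)
shiftₚ-shift (suc k) i = trans (cong next (shiftₚ-shift k i)) (sym (shift-suc k i))

-- Symmetries are described by how they treat neighbouring positions instead of by a shift amount;
-- closure under composition and inversion then needs no modular arithmetic.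
Rotation Reflection Symmetry : ∀ {n} → Permutation′ n → Set
Rotation   π = ∀ i → π ⟨$⟩ʳ next i ≡ next (π ⟨$⟩ʳ i)
Reflection π = ∀ i → next (π ⟨$⟩ʳ next i) ≡ π ⟨$⟩ʳ i
Symmetry   π = Rotation π ⊎ Reflection π

shiftₚ-rotation : ∀ {n} k → Rotation {suc n} (shiftₚ k)
shiftₚ-rotation zero    i = refl
shiftₚ-rotation (suc k) i = cong next (shiftₚ-rotation k i)

shift-next : ∀ {n} k (i : Fin (suc n)) → shift k (next i) ≡ next (shift k i)
shift-next k i = trans (sym (shiftₚ-shift k (next i)))
  (trans (shiftₚ-rotation k i) (cong next (shiftₚ-shift k i)))

symmetry-∘ : ∀ {n} (π ρ : Permutation′ n) → Symmetry π → Symmetry ρ → Symmetry (π ∘ₚ ρ)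
symmetry-∘ π ρ (inj₁ p) (inj₁ q) = inj₁ λ i → trans (cong (ρ ⟨$⟩ʳ_) (p i)) (q _)
symmetry-∘ π ρ (inj₁ p) (inj₂ q) = inj₂ λ i → trans (cong (next ∘ (ρ ⟨$⟩ʳ_)) (p i)) (q _)
symmetry-∘ π ρ (inj₂ p) (inj₁ q) = inj₂ λ i → trans (sym (q _)) (cong (ρ ⟨$⟩ʳ_) (p i))
symmetry-∘ π ρ (inj₂ p) (inj₂ q) = inj₁ λ i → trans (sym (q _)) (cong (next ∘ (ρ ⟨$⟩ʳ_)) (p i))

symmetry-flip : ∀ {n} (π : Permutation′ (suc n)) → Symmetry π → Symmetry (flip π)
symmetry-flip π (inj₁ p) = inj₁ λ i → begin
  π ⟨$⟩ˡ next i                      ≡⟨ cong (λ j → π ⟨$⟩ˡ next j) (inverseʳ π) ⟨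
  π ⟨$⟩ˡ next (π ⟨$⟩ʳ (π ⟨$⟩ˡ i))    ≡⟨ cong (π ⟨$⟩ˡ_) (p _) ⟨
  π ⟨$⟩ˡ (π ⟨$⟩ʳ next (π ⟨$⟩ˡ i))    ≡⟨ inverseˡ π ⟩
  next (π ⟨$⟩ˡ i)                    ∎
  where open ≡-Reasoning
symmetry-flip π (inj₂ p) = inj₂ λ i → let j = π ⟨$⟩ˡ next i in begin
  next j                                  ≡⟨ inverseˡ π ⟨
  π ⟨$⟩ˡ (π ⟨$⟩ʳ next j)                  ≡⟨ cong (π ⟨$⟩ˡ_) (prev-next (π ⟨$⟩ʳ next j)) ⟨
  π ⟨$⟩ˡ prev (next (π ⟨$⟩ʳ next j))      ≡⟨ cong (λ k → π ⟨$⟩ˡ prev k) (trans (p j) (inverseʳ π)) ⟩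
  π ⟨$⟩ˡ prev (next i)                    ≡⟨ cong (π ⟨$⟩ˡ_) (prev-next i) ⟩
  π ⟨$⟩ˡ i                                ∎
  where open ≡-Reasoning

-- A map commuting with `next` is determined by its value at `zero`, by induction along the circle.
commutes⇒shift : ∀ {n} (f : Fin (suc n) → Fin (suc n)) → (∀ i → f (next i) ≡ next (f i)) →
                 ∀ i → f i ≡ shift (toℕ (f zero)) i
commutes⇒shift f comm = <-weakInduction _ (sym (shift-toℕ-0 (f zero))) λ i ih → begin
  f (suc i)                                  ≡⟨ cong f (next-inject₁ i) ⟨
  f (next (inject₁ i))                       ≡⟨ comm (inject₁ i) ⟩
  next (f (inject₁ i))                       ≡⟨ cong next ih ⟩
  next (shift (toℕ (f zero)) (inject₁ i))    ≡⟨ shift-next (toℕ (f zero)) (inject₁ i) ⟨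
  shift (toℕ (f zero)) (next (inject₁ i))    ≡⟨ cong (shift (toℕ (f zero))) (next-inject₁ i) ⟩
  shift (toℕ (f zero)) (suc i)               ∎
  where open ≡-Reasoning

Arrangement : ℕ → Set
Arrangement n = Vec (Fin n) n

infix 4 _≋_

-- A form of `SameNecklace` for which reflexivity, symmetry and transitivity follow from the group
-- structure of the symmetries.
record _≋_ {n} (u v : Arrangement n) : Set where
  constructor rearrange
  field
    π        : Permutation′ n
    symmetry : Symmetry π
    lookup-π : ∀ i → lookup v i ≡ lookup u (π ⟨$⟩ʳ i)

same⇒≋ : ∀ {n} (u v : Arrangement (suc n)) → SameNecklace u v → u ≋ v
same⇒≋ u v (k , inj₁ p) = rearrange (shiftₚ (toℕ k)) (inj₁ (shiftₚ-rotation (toℕ k)))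
  λ i → trans (p i) (cong (lookup u) (sym (shiftₚ-shift (toℕ k) i)))
same⇒≋ u v (k , inj₂ p) = rearrange
  (shiftₚ (toℕ k) ∘ₚ oppositeₚ)
  (symmetry-∘ (shiftₚ (toℕ k)) oppositeₚ (inj₁ (shiftₚ-rotation (toℕ k))) (inj₂ next-opposite-next))
  λ i → trans (p i) (cong (lookup u ∘ opposite) (sym (shiftₚ-shift (toℕ k) i)))

-- A reflection followed by `opposite` commutes with `next` and is therefore a shift.
≋⇒same : ∀ {n} {u v : Arrangement (suc n)} → u ≋ v → SameNecklace u v
≋⇒same {u = u} (rearrange π (inj₁ p) q) = π ⟨$⟩ʳ zero , inj₁ λ i →
  trans (q i) (cong (lookup u) (commutes⇒shift (π ⟨$⟩ʳ_) p i))
≋⇒same {u = u} (rearrange π (inj₂ p) q) = opposite (π ⟨$⟩ʳ zero) , inj₂ λ i → begin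
  _                                                       ≡⟨ q i ⟩
  lookup u (π ⟨$⟩ʳ i)                                     ≡⟨ cong (lookup u) (opposite-involutive (π ⟨$⟩ʳ i)) ⟨
  lookup u (opposite (opposite (π ⟨$⟩ʳ i)))               ≡⟨ cong (lookup u ∘ opposite) (commutes⇒shift (opposite ∘ (π ⟨$⟩ʳ_)) commutes i) ⟩
  lookup u (opposite (shift (toℕ (opposite (π ⟨$⟩ʳ zero))) i)) ∎
  where
  open ≡-Reasoning
  commutes : ∀ i → opposite (π ⟨$⟩ʳ next i) ≡ next (opposite (π ⟨$⟩ʳ i))
  commutes i = begin
    opposite (π ⟨$⟩ʳ next i)                ≡⟨ next-opposite-next (π ⟨$⟩ʳ next i) ⟨
    next (opposite (next (π ⟨$⟩ʳ next i)))  ≡⟨ cong (next ∘ opposite) (p i) ⟩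
    next (opposite (π ⟨$⟩ʳ i))              ∎

≋-refl : ∀ {n} {u : Arrangement n} → u ≋ u
≋-refl = rearrange id (inj₁ λ _ → refl) λ _ → refl

≋-sym : ∀ {n} {u v : Arrangement (suc n)} → u ≋ v → v ≋ u
≋-sym {u = u} (rearrange π s p) = rearrange (flip π) (symmetry-flip π s)
  λ i → sym (trans (p _) (cong (lookup u) (inverseʳ π)))

≋-trans : ∀ {n} {u v w : Arrangement n} → u ≋ v → v ≋ w → u ≋ w
≋-trans (rearrange π s p) (rearrange ρ t q) =
  rearrange (ρ ∘ₚ π) (symmetry-∘ ρ π t s) λ i → trans (q i) (p _)

-- Arrangements as lists of entries

entries : ∀ {m n} → Vec (Fin n) m → List ℕ
entries v = tabulate (toℕ ∘ lookup v)

tabulate-injective : ∀ {A : Set} {n} {f g : Fin n → A} → tabulate f ≡ tabulate g → ∀ i → f i ≡ g i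
tabulate-injective eq zero    = List.∷-injectiveˡ eq
tabulate-injective eq (suc i) = tabulate-injective (List.∷-injectiveʳ eq) i

entries-injective : ∀ {m n} (v w : Vec (Fin n) m) → entries v ≡ entries w →
                    ∀ i → lookup v i ≡ lookup w i
entries-injective v w eq i =
  toℕ-injective (tabulate-injective {f = toℕ ∘ lookup v} {toℕ ∘ lookup w} eq i)

tabulate⁻ : ∀ {A : Set} {n} {f : Fin n → A} → Unique (tabulate f) → ∀ {i j} → f i ≡ f j → i ≡ j
tabulate⁻ (p ∷ u) {zero}  {zero}  eq = refl
tabulate⁻ (p ∷ u) {zero}  {suc j} eq = contradiction eq (All.tabulate⁻ p j)
tabulate⁻ (p ∷ u) {suc i} {zero}  eq = contradiction (sym eq) (All.tabulate⁻ p i)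
tabulate⁻ (p ∷ u) {suc i} {suc j} eq = cong suc (tabulate⁻ u eq)

tabulate-interval : ∀ s n → tabulate {n = n} (λ i → toℕ i + s) ≡ interval s n
tabulate-interval s zero    = refl
tabulate-interval s (suc n) = cong (s ∷_)
  (trans (List.tabulate-cong (λ i → sym (+-suc (toℕ i) s))) (tabulate-interval (suc s) n))

tabulate-toℕ : ∀ n → tabulate {n = n} toℕ ≡ interval 0 n
tabulate-toℕ n = trans (List.tabulate-cong (λ i → sym (+-identityʳ (toℕ i)))) (tabulate-interval 0 n)

∈-interval-< : ∀ {n x} → x ∈ interval 0 n → x < n
∈-interval-< {n} x∈ with i , refl ← ∈-tabulate⁻ (subst (_ ∈_) (sym (tabulate-toℕ n)) x∈) = toℕ<n i

entries-surjective : ∀ {n} m (l : List ℕ) → length l ≡ m → All (_< n) l →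
                     ∃ λ (v : Vec (Fin n) m) → entries v ≡ l
entries-surjective _ []      refl []        = [] , refl
entries-surjective _ (x ∷ l) refl (x<n ∷ p) with entries-surjective _ l refl p
... | v , eq = fromℕ< x<n ∷ v , cong₂ _∷_ (toℕ-fromℕ< x<n) eq

-- The endpoint `b` is left free so that the induction can drop the first entry; a circuit is the
-- case where `b` is `f zero`.
Path-tabulate⁺ : ∀ {n b} (f : Fin (suc n) → ℕ) → (∀ i → f (inject₁ i) ∼ f (suc i)) →
                 f (fromℕ n) ∼ b → Path (f zero) (tabulate (f ∘ suc)) b
Path-tabulate⁺ {zero}  f p q = end q
Path-tabulate⁺ {suc n} f p q = p zero ∷ Path-tabulate⁺ (f ∘ suc) (p ∘ suc) q

Path-tabulate⁻ : ∀ {n b} (f : Fin (suc n) → ℕ) → Path (f zero) (tabulate (f ∘ suc)) b →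
                 (∀ i → f (inject₁ i) ∼ f (suc i)) × f (fromℕ n) ∼ b
Path-tabulate⁻ {zero}  f (end q) = (λ ()) , q
Path-tabulate⁻ {suc n} f (p ∷ ps) with Path-tabulate⁻ (f ∘ suc) ps
... | ps′ , q = (λ { zero → p ; (suc i) → ps′ i }) , q

lookup-injective : ∀ {n} (v : Arrangement n) → (∀ x → UsedOnce v x) → ∀ {i j} → lookup v i ≡ lookup v j → i ≡ j
lookup-injective v once {i} {j} eq with once (lookup v i)
... | k , _ , unique = trans (sym (unique refl)) (unique (sym eq))

Adjacent-sym : ∀ {n} (x y : Fin n) → Adjacent 1 3 x y → Adjacent 1 3 y x
Adjacent-sym x y = ∼⇒distance ∘ ∼-sym ∘ distance⇒∼ (toℕ x) (toℕ y)

-- Two lists without repetitions and with the same elements are permutations of each other.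
usedOnce⇒↭ : ∀ {n} (v : Arrangement n) → (∀ x → UsedOnce v x) → entries v ↭ interval 0 n
usedOnce⇒↭ {n} v once = subst (entries v ↭_) (tabulate-toℕ n) (∼bag⇒↭
  (unique∧set⇒bag (Unique.tabulate⁺ (lookup-injective v once ∘ toℕ-injective)) (Unique.tabulate⁺ toℕ-injective)
    (mk⇔ to from)))
  where
  to : ∀ {x} → x ∈ entries v → x ∈ tabulate {n = n} toℕ
  to x∈ with i , refl ← ∈-tabulate⁻ x∈ = ∈-tabulate⁺ (lookup v i)
  from : ∀ {x} → x ∈ tabulate {n = n} toℕ → x ∈ entries v
  from x∈ with x , refl ← ∈-tabulate⁻ x∈ with i , vi≡x , _ ← once x =
    subst (_∈ entries v) (cong toℕ vi≡x) (∈-tabulate⁺ i)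

↭⇒usedOnce : ∀ {n} (v : Arrangement n) → entries v ↭ interval 0 n → ∀ x → UsedOnce v x
↭⇒usedOnce {n} v π x with ∈-tabulate⁻ (∈-resp-↭ π′ (∈-tabulate⁺ x))
  where
  π′ : tabulate {n = n} toℕ ↭ entries v
  π′ = subst (_↭ entries v) (sym (tabulate-toℕ n)) (↭-sym π)
... | i , x≡vi = i , sym (toℕ-injective x≡vi) , λ vj≡x →
  tabulate⁻ unique (trans (sym x≡vi) (cong toℕ (sym vj≡x)))
  where
  unique : Unique (entries v)
  unique = Unique-resp-↭ (setoid ℕ) (↭⇒↭ₛ (↭-sym π))
             (subst Unique (tabulate-toℕ n) (Unique.tabulate⁺ toℕ-injective))

necklace⇒Path : ∀ {n} (v : Arrangement (suc n)) → IsNecklace 1 3 v →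
                let f = toℕ ∘ lookup v in Path (f zero) (tabulate (f ∘ suc)) (f zero)
necklace⇒Path {n} v (_ , adj) = Path-tabulate⁺ f
  (λ i → subst (λ j → f (inject₁ i) ∼ f j) (next-inject₁ i) (adj′ (inject₁ i)))
  (subst (λ j → f (fromℕ n) ∼ f j) (next-fromℕ n) (adj′ (fromℕ n)))
  where
  f = toℕ ∘ lookup v
  adj′ : ∀ i → f i ∼ f (next i)
  adj′ i = distance⇒∼ (f i) (f (next i)) (adj i)

Path⇒adjacent : ∀ {n} (v : Arrangement (suc n)) →
                let f = toℕ ∘ lookup v in Path (f zero) (tabulate (f ∘ suc)) (f zero) →
                ∀ i → Adjacent 1 3 (lookup v i) (lookup v (next i))
Path⇒adjacent {n} v ps i with Path-tabulate⁻ (toℕ ∘ lookup v) ps | view i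
... | _ , q | ‵fromℕ = subst (λ j → Adjacent 1 3 (lookup v (fromℕ n)) (lookup v j))
                             (sym (next-fromℕ n)) (∼⇒distance q)
... | p , _ | ‵inject₁ j = subst (λ k → Adjacent 1 3 (lookup v (inject₁ j)) (lookup v k))
                                 (sym (next-inject₁ j)) (∼⇒distance (p j))

-- The last entry is a neighbour of 0, so it is 1 or 3, and 1 is already used. Cutting off 0, 1 and
-- 3 leaves a path from 1 to 3 through the rest.
circuit⇒Gap : ∀ {r xs} → Path 0 (1 ∷ xs) 0 → 0 ∷ 1 ∷ xs ↭ interval 0 (4 + r) →
              ∃ λ ys → xs ≡ ys ∷ʳ 3 × Gap 0 r ys
circuit⇒Gap {xs = xs} ps π with drop-∷ (drop-∷ π) | initLast xs
... | π′ | [] = contradiction (↭-sym π′) ¬x∷xs↭[]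
... | π′ | ys ∷ʳ′ z with Path-++⁻ (1 ∷ ys) ps
...   | _ ∷ qs , end down₃ = ys , refl ,
          (qs , subst (_↭ _) (List.++-identityʳ ys) (drop-mid ys [ 2 ] π′))
...   | _      , end down₁ = contradiction (∈-resp-↭ π′ (∈-++⁺ʳ ys (here refl))) (below∉interval 0 1 {2 + _})

Gap⇒circuit : ∀ {r ys} → Gap 0 r ys →
              Path 0 (1 ∷ ys ∷ʳ 3) 0 × 0 ∷ 1 ∷ ys ∷ʳ 3 ↭ interval 0 (4 + r)
Gap⇒circuit {ys = ys} (ps , π) =
  up₁ ∷ Path-++⁺ ys ps (end down₃) ,
  prep 0 (prep 1 (↭-trans (↭-sym (∷↭∷ʳ 3 ys)) (↭-trans (prep 3 π) (swap 3 2 ↭-refl))))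

-- Canonical forms

code : List ℕ → List ℕ
code ys = 0 ∷ 1 ∷ ys ∷ʳ 3

necklace⇒code : ∀ {r} (v : Arrangement (4 + r)) → IsNecklace 1 3 v →
                lookup v zero ≡ zero → lookup v (suc zero) ≡ suc zero →
                ∃ λ ys → entries v ≡ code ys × ys ∈ gaps 0 r
necklace⇒code {r} v nv v₀ v₁ =
  let ys , eq , gap = circuit⇒Gap
        (subst₂ (λ x y → Path x (y ∷ xs) x) (cong toℕ v₀) (cong toℕ v₁) (necklace⇒Path v nv))
        (subst₂ (λ x y → x ∷ y ∷ xs ↭ interval 0 (4 + r)) (cong toℕ v₀) (cong toℕ v₁)
                (usedOnce⇒↭ v (proj₁ nv)))
  in ys , cong₂ _∷_ (cong toℕ v₀) (cong₂ _∷_ (cong toℕ v₁) eq) , gaps-complete 0 r gap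
  where
  xs : List ℕ
  xs = tabulate λ i → toℕ (lookup v (suc (suc i)))

code⇒necklace : ∀ {r ys} → ys ∈ gaps 0 r →
                ∃ λ (v : Arrangement (4 + r)) → IsNecklace 1 3 v × entries v ≡ code ys
code⇒necklace {r} {ys} ys∈ =
  let ps , perm = Gap⇒circuit (gaps-sound 0 r ys∈)
      v , eq    = entries-surjective (4 + r) (code ys)
                    (trans (↭-length perm) (List.length-iterate suc 0 (4 + r)))
                    (All.tabulate λ x∈ → ∈-interval-< (∈-resp-↭ perm x∈))
  in v , ( ↭⇒usedOnce v (subst (_↭ interval 0 (4 + r)) (sym eq) perm)
         , Path⇒adjacent v (circuit ps eq)) , eq
  where
  circuit : ∀ {x xs} → Path 0 (1 ∷ ys ∷ʳ 3) 0 → x ∷ xs ≡ code ys → Path x xs x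
  circuit ps refl = ps

rearrange-necklace : ∀ {n} {v w : Arrangement (suc n)} → v ≋ w →
                     IsNecklace 1 3 v → IsNecklace 1 3 w
rearrange-necklace {v = v} {w} (rearrange π s p) (once , adj) = once′ , adj′ s
  where
  once′ : ∀ x → UsedOnce w x
  once′ x with once x
  ... | i , vi≡x , unique =
    π ⟨$⟩ˡ i , trans (p _) (trans (cong (lookup v) (inverseʳ π)) vi≡x) ,
    λ wj≡x → trans (cong (π ⟨$⟩ˡ_) (unique (trans (sym (p _)) wj≡x))) (inverseˡ π)

  adj′ : Symmetry π → ∀ i → Adjacent 1 3 (lookup w i) (lookup w (next i))
  adj′ (inj₁ q) i = subst₂ (Adjacent 1 3) (sym (p i))
    (sym (trans (p (next i)) (cong (lookup v) (q i)))) (adj (π ⟨$⟩ʳ i))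
  -- A reflection sends the pair `i`, `next i` to a neighbouring pair in the opposite order, whose
  -- first position is the image of `next i`.
  adj′ (inj₂ q) i = Adjacent-sym (lookup w (next i)) (lookup w i)
    (subst₂ (Adjacent 1 3) (sym (p (next i)))
      (sym (trans (p i) (cong (lookup v) (sym (q i))))) (adj (π ⟨$⟩ʳ next i)))

neighbour-of-0 : ∀ {r} (x : Fin (4 + r)) → toℕ x ∼ 0 → x ≡ suc zero ⊎ x ≡ suc (suc (suc zero))
neighbour-of-0 (suc zero)             down₁ = inj₁ refl
neighbour-of-0 (suc (suc (suc zero))) down₃ = inj₂ refl

-- The two entries beside 0 are distinct and belong to 1 and 3, so one of them is 1. A rotation
-- suffices if 1 follows 0, a reflection if it precedes 0.
canonical : ∀ {r} (v : Arrangement (4 + r)) → IsNecklace 1 3 v →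
            ∃ λ π → Symmetry π × lookup v (π ⟨$⟩ʳ zero) ≡ zero × lookup v (π ⟨$⟩ʳ suc zero) ≡ suc zero
canonical {r} v (once , adj) = choose (neighbour-of-0 (lookup v (next p)) next∼0)
                                      (neighbour-of-0 (lookup v (prev p)) prev∼0)
  where
  open ≡-Reasoning

  p = proj₁ (once zero)

  vp≡0 : lookup v p ≡ zero
  vp≡0 = proj₁ (proj₂ (once zero))

  next∼0 : toℕ (lookup v (next p)) ∼ 0
  next∼0 = ∼-sym (subst (λ x → toℕ x ∼ toℕ (lookup v (next p))) vp≡0
                        (distance⇒∼ (toℕ (lookup v p)) _ (adj p)))

  prev∼0 : toℕ (lookup v (prev p)) ∼ 0
  prev∼0 = subst (λ x → toℕ (lookup v (prev p)) ∼ toℕ x)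
                 (trans (cong (lookup v) (next-prev p)) vp≡0)
                 (distance⇒∼ (toℕ (lookup v (prev p))) _ (adj (prev p)))

  -- Shifting `zero` by this amount gives `opposite p`, which the final `opposite` turns into `p`.
  k = toℕ (opposite p)

  rotation reflection : Permutation′ (4 + r)
  rotation   = shiftₚ (toℕ p)
  reflection = shiftₚ k ∘ₚ oppositeₚ

  rotation-0 : rotation ⟨$⟩ʳ zero ≡ p
  rotation-0 = trans (shiftₚ-shift (toℕ p) zero) (shift-toℕ-0 p)

  rotation-1 : rotation ⟨$⟩ʳ suc zero ≡ next p
  rotation-1 = begin
    rotation ⟨$⟩ʳ suc zero       ≡⟨ cong (rotation ⟨$⟩ʳ_) (next-inject₁ zero) ⟨
    rotation ⟨$⟩ʳ next zero      ≡⟨ shiftₚ-rotation (toℕ p) zero ⟩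
    next (rotation ⟨$⟩ʳ zero)    ≡⟨ cong next rotation-0 ⟩
    next p                       ∎

  shiftₚ-k-0 : shiftₚ k ⟨$⟩ʳ zero ≡ opposite p
  shiftₚ-k-0 = trans (shiftₚ-shift k zero) (shift-toℕ-0 (opposite p))

  reflection-0 : reflection ⟨$⟩ʳ zero ≡ p
  reflection-0 = trans (cong opposite shiftₚ-k-0) (opposite-involutive p)

  reflection-1 : reflection ⟨$⟩ʳ suc zero ≡ prev p
  reflection-1 = begin
    reflection ⟨$⟩ʳ suc zero              ≡⟨ cong (reflection ⟨$⟩ʳ_) (next-inject₁ zero) ⟨
    opposite (shiftₚ k ⟨$⟩ʳ next zero)    ≡⟨ cong opposite (shiftₚ-rotation k zero) ⟩
    opposite (next (shiftₚ k ⟨$⟩ʳ zero))  ≡⟨ cong (opposite ∘ next) shiftₚ-k-0 ⟩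
    prev p                                ∎

  choose : lookup v (next p) ≡ suc zero ⊎ lookup v (next p) ≡ suc (suc (suc zero)) →
           lookup v (prev p) ≡ suc zero ⊎ lookup v (prev p) ≡ suc (suc (suc zero)) →
           ∃ λ π → Symmetry π × lookup v (π ⟨$⟩ʳ zero) ≡ zero × lookup v (π ⟨$⟩ʳ suc zero) ≡ suc zero
  choose (inj₁ next≡1) _ =
    rotation , inj₁ (shiftₚ-rotation (toℕ p)) ,
    trans (cong (lookup v) rotation-0) vp≡0 , trans (cong (lookup v) rotation-1) next≡1
  choose (inj₂ _) (inj₁ prev≡1) =
    reflection ,
    symmetry-∘ (shiftₚ k) oppositeₚ (inj₁ (shiftₚ-rotation k)) (inj₂ next-opposite-next) ,
    trans (cong (lookup v) reflection-0) vp≡0 , trans (cong (lookup v) reflection-1) prev≡1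
  -- If 3 stood on both sides, `next p` and `prev p` would coincide.
  choose (inj₂ next≡3) (inj₂ prev≡3) = contradiction
    (trans (cong next (lookup-injective v once (trans next≡3 (sym prev≡3)))) (next-prev p))
    (next²≢id p)

-- A rotation fixing position 0 is the identity. A reflection fixing 0 moves position 1 to the
-- predecessor of 0, which differs from 1.
symmetry-fixing-01 : ∀ {n} (π : Permutation′ (3 + n)) → Symmetry π →
                     π ⟨$⟩ʳ zero ≡ zero → π ⟨$⟩ʳ suc zero ≡ suc zero → ∀ i → π ⟨$⟩ʳ i ≡ i
symmetry-fixing-01 π (inj₁ p) π0 _ i =
  trans (commutes⇒shift (π ⟨$⟩ʳ_) p i) (trans (cong (λ x → shift (toℕ x) i) π0) (shift-0 i))
symmetry-fixing-01 π (inj₂ p) π0 π1 _ = contradiction next²0≡0 (next²≢id zero)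
  where
  open ≡-Reasoning
  next²0≡0 : next (next zero) ≡ zero
  next²0≡0 = begin
    next (next zero)             ≡⟨ cong next (next-inject₁ zero) ⟩
    next (suc zero)              ≡⟨ cong next π1 ⟨
    next (π ⟨$⟩ʳ suc zero)       ≡⟨ cong (λ i → next (π ⟨$⟩ʳ i)) (next-inject₁ zero) ⟨
    next (π ⟨$⟩ʳ next zero)      ≡⟨ p zero ⟩
    π ⟨$⟩ʳ zero                  ≡⟨ π0 ⟩
    zero                         ∎

-- A relation on classes rather than a function: only necklaces are guaranteed a code, and it is
-- found by searching the class for a canonical arrangement.
record HasCode {r} (v : Arrangement (4 + r)) (ys : List ℕ) : Set where
  constructor hasCode
  field
    {canon}   : Arrangement (4 + r)
    v≋canon   : v ≋ canon
    entries-≡ : entries canon ≡ code ys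

hasCode-resp : ∀ {r ys} {u v : Arrangement (4 + r)} → u ≋ v → HasCode v ys → HasCode u ys
hasCode-resp u≋v (hasCode v≋w eq) = hasCode (≋-trans u≋v v≋w) eq

necklace-hasCode : ∀ {r} (v : Arrangement (4 + r)) → IsNecklace 1 3 v →
                   ∃ λ ys → ys ∈ gaps 0 r × HasCode v ys
necklace-hasCode v nv with π , s , v₀ , v₁ ← canonical v nv =
  let w            = Vec.tabulate (lookup v ∘ (π ⟨$⟩ʳ_))
      w-lookup     = Vec.lookup∘tabulate (lookup v ∘ (π ⟨$⟩ʳ_))
      v≋w          = rearrange {v = w} π s w-lookup
      ys , eq , ∈ys = necklace⇒code w (rearrange-necklace v≋w nv)
                       (trans (w-lookup zero) v₀) (trans (w-lookup (suc zero)) v₁)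
  in ys , ∈ys , hasCode v≋w eq

hasCode-injective : ∀ {r ys} {u v : Arrangement (4 + r)} → HasCode u ys → HasCode v ys → u ≋ v
hasCode-injective (hasCode {w} u≋w p) (hasCode {x} v≋x q) = ≋-trans u≋w (≋-trans w≋x (≋-sym v≋x))
  where
  w≋x : w ≋ x
  w≋x = rearrange id (inj₁ λ _ → refl) λ i → entries-injective x w (trans q (sym p)) i

-- Two canonical arrangements of one class differ by a symmetry. Both have 0 and 1 in the first two
-- positions and entries are distinct, so the symmetry fixes these positions and is the identity.
hasCode-functional : ∀ {r ys zs} (v : Arrangement (4 + r)) → IsNecklace 1 3 v →
                     HasCode v ys → HasCode v zs → ys ≡ zs
hasCode-functional {r} {ys} {zs} v nv (hasCode {w} v≋w p) (hasCode {x} v≋x q) =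
  List.∷ʳ-injectiveˡ ys zs (List.∷-injectiveʳ (List.∷-injectiveʳ (trans (sym p) (trans w≡x q))))
  where
  open _≋_ (≋-trans (≋-sym v≋w) v≋x)
  open ≡-Reasoning

  fixes : ∀ i → toℕ (lookup w i) ≡ toℕ (lookup x i) → π ⟨$⟩ʳ i ≡ i
  fixes i wi≡xi = lookup-injective w (proj₁ (rearrange-necklace v≋w nv))
    (trans (sym (lookup-π i)) (sym (toℕ-injective wi≡xi)))

  π≡id : ∀ i → π ⟨$⟩ʳ i ≡ i
  π≡id = symmetry-fixing-01 π symmetry
    (fixes zero (trans (List.∷-injectiveˡ p) (sym (List.∷-injectiveˡ q))))
    (fixes (suc zero) (trans (List.∷-injectiveˡ (List.∷-injectiveʳ p))
                             (sym (List.∷-injectiveˡ (List.∷-injectiveʳ q)))))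

  w≡x : entries w ≡ entries x
  w≡x = List.tabulate-cong {f = toℕ ∘ lookup w} {toℕ ∘ lookup x} λ i → cong toℕ (begin
    lookup w i           ≡⟨ cong (lookup w) (π≡id i) ⟨
    lookup w (π ⟨$⟩ʳ i)  ≡⟨ lookup-π i ⟨
    lookup x i           ∎)

-- The number of necklaces

∈-allVecs : ∀ {n k} (v : Vec (Fin n) k) → v ∈ allVecs n k
∈-allVecs []      = here refl
∈-allVecs (x ∷ v) = ∈-cartesianProductWith⁺ _∷_ (∈-allFin x) (∈-allVecs v)

-- The passage between `SameNecklace`, used by `N`, and `_≋_`, used by the codes, is confined to
-- this lemma.
N≡length : ∀ {n} {bs : List (List ℕ)} (Code : Arrangement (suc n) → List ℕ → Set) →
  Unique bs →
  (∀ {u v b} → u ≋ v → Code v b → Code u b) →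
  (∀ v → IsNecklace 1 3 v → ∃ λ b → b ∈ bs × Code v b) →
  (∀ {b} → b ∈ bs → ∃ λ v → IsNecklace 1 3 v × Code v b) →
  (∀ {u v b} → Code u b → Code v b → u ≋ v) →
  (∀ {b c} v → IsNecklace 1 3 v → Code v b → Code v c → b ≡ c) →
  N 1 3 (suc n) ≡ length bs
N≡length Code unique resp cover represent injective functional =
  length-classes sameNecklace? (λ v → ≋⇒same (≋-refl {u = v}))
    (λ u v w p q → ≋⇒same (≋-trans (same⇒≋ u v p) (same⇒≋ v w q)))
    (isNecklace? 1 3) ∈-allVecs Code unique
    (λ u v p → resp (same⇒≋ u v p)) cover represent
    (λ u v p q → ≋⇒same (injective p q)) functional

N≡length-gaps : ∀ r → N 1 3 (4 + r) ≡ length (gaps 0 r)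
N≡length-gaps r = N≡length {3 + r} (HasCode {r}) (gaps-unique 0 r) hasCode-resp necklace-hasCode
  (λ ys∈ → let w , nw , eq = code⇒necklace ys∈ in w , nw , hasCode ≋-refl eq)
  hasCode-injective hasCode-functional

N≡evenF : ∀ n → 4 ≤ n → N 1 3 n ≡ evenF n
N≡evenF n 4≤n = subst (λ n → N 1 3 n ≡ evenF n) (m+[n∸m]≡n 4≤n)
  (trans (N≡length-gaps (n ∸ 4)) (length-gaps 0 (n ∸ 4)))

evenF-recurrence : ∀ n → 4 ≤ n → evenF n ≡ evenF (n ∸ 2) + evenF (n ∸ 4)
evenF-recurrence _ (s≤s (s≤s (s≤s (s≤s z≤n)))) = refl

evenF-double : ∀ m → evenF (m * 2) ≡ F m
evenF-double 0             = refl
evenF-double 1             = refl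
evenF-double (suc (suc m)) = cong₂ _+_ (evenF-double (suc m)) (evenF-double m)

evenF-odd : ∀ n → 2 ∤ n → evenF n ≡ 0
evenF-odd 0 2∤n = contradiction (2 ∣0) 2∤n
evenF-odd 1 2∤n = refl
evenF-odd 2 2∤n = contradiction ∣-refl 2∤n
evenF-odd 3 2∤n = refl
evenF-odd (suc (suc (suc (suc n)))) 2∤n =
  cong₂ _+_ (evenF-odd (suc (suc n)) (2∤n ∘ ∣m∣n⇒∣m+n ∣-refl))
            (evenF-odd n (2∤n ∘ ∣m∣n⇒∣m+n (divides 2 refl)))

mainTheorem4 : (∀ n → 8 ≤ n → N 1 3 n ≡ N 1 3 (n ∸ 2) + N 1 3 (n ∸ 4))
    × (∀ n → 4 ≤ n → 2 ∣ n → N 1 3 n ≡ F (n / 2))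
    × (∀ n → 5 ≤ n → 2 ∤ n → N 1 3 n ≡ 0)
mainTheorem4 = recurrence , even , odd
  where
  open ≡-Reasoning

  recurrence : ∀ n → 8 ≤ n → N 1 3 n ≡ N 1 3 (n ∸ 2) + N 1 3 (n ∸ 4)
  recurrence n 8≤n = begin
    N 1 3 n                        ≡⟨ N≡evenF n (≤-trans (m≤m+n 4 4) 8≤n) ⟩
    evenF n                        ≡⟨ evenF-recurrence n (≤-trans (m≤m+n 4 4) 8≤n) ⟩
    -- The bound `8 ≤ n` keeps `n ∸ 4` at 4 or more, within the range of `N≡evenF`.
    evenF (n ∸ 2) + evenF (n ∸ 4)  ≡⟨ cong₂ _+_ (N≡evenF (n ∸ 2) (≤-trans (m≤m+n 4 2) (∸-monoˡ-≤ 2 8≤n)))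
                                               (N≡evenF (n ∸ 4) (∸-monoˡ-≤ 4 8≤n)) ⟨
    N 1 3 (n ∸ 2) + N 1 3 (n ∸ 4)  ∎

  even : ∀ n → 4 ≤ n → 2 ∣ n → N 1 3 n ≡ F (n / 2)
  even n 4≤n (divides q n≡q*2) = begin
    N 1 3 n         ≡⟨ N≡evenF n 4≤n ⟩
    evenF n         ≡⟨ cong evenF n≡q*2 ⟩
    evenF (q * 2)   ≡⟨ evenF-double q ⟩
    F q             ≡⟨ cong F (m*n/n≡m q 2) ⟨
    F (q * 2 / 2)   ≡⟨ cong (λ m → F (m / 2)) n≡q*2 ⟨
    F (n / 2)       ∎

  odd : ∀ n → 5 ≤ n → 2 ∤ n → N 1 3 n ≡ 0
  odd n 5≤n 2∤n = trans (N≡evenF n (≤-trans (n≤1+n 4) 5≤n)) (evenF-odd n 2∤n)
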